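{- Given an $n$-vertex graph $G$ as a stream in the AL model and an integer $k$, one can produce (as a stream) a kernel with at most $2k$ vertices for \textsc{Vertex Cover} $[k]$ using $O(k^2)$ passes and $\tilde{O}(k)$ bits of memory. If $G$ is instead given as a stream in the EA model, the same can be done using $O(k^3)$ passes and $\tilde{O}(k)$ bits of memory.
   Context: \textsc{Vertex Cover} $[k]$: given a graph $G$ and integer $k$, decide whether $G$ has a vertex cover (a vertex set meeting every edge) of size at most $k$. A kernel of size $2k$ is an instance $(G',k')$ with $|V(G')| \le 2k$ and $k' \le k$ such that $G$ has a vertex cover of size at most $k$ if and only if $G'$ has one of size at most $k'$ (the procedure may alternatively correctly report that no solution exists). In the Adjacency List (AL) model the graph arrives as a sequence of vertices in arbitrary fixed order, each with the full list of its incident edges (each edge appears twice); in the Edge Arrival (EA) model each edge appears exactly once, in arbitrary fixed order. A $p$-pass algorithm reads the stream $p$ times with unlimited computation. $\tilde{O}(k)$ denotes $O(k)$ up to factors polylogarithmic in $n$. -}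

module Defs where

open import Data.Nat using (ℕ; zero; suc; _+_; _*_; _^_; _≤_; _<_)
open import Data.Nat.Logarithm using (⌊log₂_⌋)
open import Data.Fin using (Fin; toℕ)
open import Data.Fin.Subset using (Subset; _∈_; ∣_∣)
open import Data.Bool using (Bool)
open import Data.Vec using (Vec)
open import Data.List using (List; []; _∷_; _++_; map; concatMap; allFin)
open import Data.List.Membership.Propositional renaming (_∈_ to _∈ₗ_)
open import Data.List.Relation.Unary.All using (All)
open import Data.List.Relation.Unary.Unique.Propositional using (Unique)
open import Data.List.Relation.Unary.AllPairs using (AllPairs)
open import Data.List.Relation.Binary.Permutation.Propositional using (_↭_)
open import Data.Product using (Σ; _×_; _,_; proj₁; proj₂)
open import Data.Sum using (_⊎_)
open import Relation.Binary.PropositionalEquality using (_≡_; _≢_)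
open import Relation.Nullary using (¬_)
open import Function.Bundles using (_⇔_)

record Graph (n : ℕ) : Set₁ where
  field
    Adj    : Fin n → Fin n → Set
    sym    : ∀ {u v} → Adj u v → Adj v u
    irrefl : ∀ {u} → ¬ Adj u u
open Graph public

IsVertexCover : ∀ {n} → (Fin n → Fin n → Set) → Subset n → Set
IsVertexCover {n} E S = ∀ (u v : Fin n) → E u v → (u ∈ S) ⊎ (v ∈ S)

HasVCAtMost : ∀ {n} → (Fin n → Fin n → Set) → ℕ → Set
HasVCAtMost {n} E k = Σ (Subset n) λ S → (∣ S ∣ ≤ k) × IsVertexCover E S

-- AL model tokens: a vertex header, or an edge {u,v} listed under u.
data ALTok (n : ℕ) : Set where
  vtx : Fin n → ALTok n
  inc : Fin n → Fin n → ALTok n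

IsALStream : ∀ {n} → Graph n → List (ALTok n) → Set
IsALStream {n} G s =
  Σ (List (Fin n)) λ order → Σ (Fin n → List (Fin n)) λ nbrs →
    (order ↭ allFin n)
    × (∀ u → Unique (nbrs u))
    × (∀ u v → (v ∈ₗ nbrs u) ⇔ Adj G u v)
    × (s ≡ concatMap (λ u → vtx u ∷ map (inc u) (nbrs u)) order)

SameEdge : ∀ {n} → Fin n × Fin n → Fin n × Fin n → Set
SameEdge (a , b) (c , d) = ((a ≡ c) × (b ≡ d)) ⊎ ((a ≡ d) × (b ≡ c))

IsEAStream : ∀ {n} → Graph n → List (Fin n × Fin n) → Set
IsEAStream {n} G s =
    All (λ e → Adj G (proj₁ e) (proj₂ e)) s
  × (∀ u v → Adj G u v → ((u , v) ∈ₗ s) ⊎ ((v , u) ∈ₗ s))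
  × AllPairs (λ e f → ¬ SameEdge e f) s

data OutTok : Set where
  size  : ℕ → OutTok         -- number m of vertices of G' (vertices 0..m-1)
  param : ℕ → OutTok
  edge  : ℕ → ℕ → OutTok
  no    : OutTok

KAdj : (m : ℕ) → List (ℕ × ℕ) → Fin m → Fin m → Set
KAdj m es i j = ((toℕ i , toℕ j) ∈ₗ es) ⊎ ((toℕ j , toℕ i) ∈ₗ es)

ValidKernelOutput : ∀ {n} → Graph n → ℕ → List OutTok → Set
ValidKernelOutput {n} G k out =
    ((out ≡ no ∷ []) × ¬ HasVCAtMost (Adj G) k)
  ⊎ Σ ℕ λ m → Σ ℕ λ k' → Σ (List (ℕ × ℕ)) λ es →
      (out ↭ (size m ∷ param k' ∷ map (λ e → edge (proj₁ e) (proj₂ e)) es))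
      × (m ≤ 2 * k) × (k' ≤ k)
      × All (λ e → (proj₁ e < m) × (proj₂ e < m) × (proj₁ e ≢ proj₂ e)) es
      × (HasVCAtMost (Adj G) k ⇔ HasVCAtMost (KAdj m es) k')

-- Multi-pass streaming algorithms with b bits of memory
-- (unlimited computation: transitions are arbitrary functions).

record StreamAlg (In : Set) (b : ℕ) : Set where
  field
    init    : Vec Bool b
    step    : Vec Bool b → In → Vec Bool b × List OutTok
    endPass : Vec Bool b → Vec Bool b × List OutTok
open StreamAlg public

readStream : ∀ {In : Set} {b : ℕ} → (Vec Bool b → In → Vec Bool b × List OutTok)
           → Vec Bool b → List In → Vec Bool b × List OutTok
readStream f σ [] = σ , []
readStream f σ (x ∷ xs) with f σ x
... | σ₁ , o₁ with readStream f σ₁ xs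
...   | σ₂ , o₂ = σ₂ , (o₁ ++ o₂)

onePass : ∀ {In : Set} {b : ℕ} → StreamAlg In b → Vec Bool b → List In → Vec Bool b × List OutTok
onePass A σ s with readStream (step A) σ s
... | σ₁ , o₁ with endPass A σ₁
...   | σ₂ , o₂ = σ₂ , (o₁ ++ o₂)

passes : ∀ {In : Set} {b : ℕ} → StreamAlg In b → ℕ → Vec Bool b → List In → Vec Bool b × List OutTok
passes A zero σ s = σ , []
passes A (suc p) σ s with onePass A σ s
... | σ₁ , o₁ with passes A p σ₁ s
...   | σ₂ , o₂ = σ₂ , (o₁ ++ o₂)

runOutput : ∀ {In : Set} {b : ℕ} → StreamAlg In b → ℕ → List In → List OutTok
runOutput A p s = proj₂ (passes A p (init A) s)

-- Õ(k) memory bound: c · (k+1) · (1 + ⌊log₂ n⌋)^d bits.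
MemBound : ℕ → ℕ → ℕ → ℕ → ℕ
MemBound c d n k = c * (suc k) * (suc ⌊log₂ n ⌋ ^ d)

{-# OPTIONS --safe #-}

-- Let H be the bipartite double cover of G. A vertex cover of G of size k yields one
-- of H of size 2k, so a matching of H with more than 2k edges refutes the instance.
-- Otherwise a maximum matching M of H comes with a vertex cover of H of size |M| (König),
-- that is, with an optimal half-integral vertex cover y of G of weight |M|/2 ≤ k, and by
-- Nemhauser–Trotter the subgraph induced by the vertices of weight 1/2, with k lowered
-- by the number of vertices of weight 1, is a kernel on at most |M| vertices.
--
-- M is found by augmenting paths. The memory holds the matching and, for each matched
-- edge whose right endpoint has been reached by an alternating path, the parent of that
-- endpoint; free left vertices are reached implicitly. Each edge of the stream is tried
-- in both directions: it may mark a matched edge or complete an augmenting path. A pass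
-- that changes nothing certifies the König cover. Any other pass increases the potential
-- |M|(2k+1) + #marks, which stays below (2k+1)², so O(k²) passes suffice in both models.
module Submission where

open import Defs hiding (sym; no)
open import Data.Nat using (ℕ; zero; suc; _+_; _*_; _^_; _∸_; _≤_; _<_; z≤n; s≤s; s≤s⁻¹; _≤?_; _<?_; _≟_)
open import Data.Nat.Properties hiding (_≟_; _≤?_; _<?_)
open import Data.Nat.ListAction using (sum)
open import Data.Nat.ListAction.Properties using (sum-↭)
open import Data.Nat.Logarithm using (⌊log₂_⌋; ⌊log₂⌋-mono-≤; ⌊log₂[2^n]⌋≡n)
open import Data.Nat.Solver using (module +-*-Solver)
open import Data.Fin as Fin using (Fin; zero; suc; toℕ; fromℕ<)
open import Data.Fin.Properties using (toℕ-fromℕ<; toℕ<n; toℕ-injective; toℕ-inject≤; combine-remQuot; 2↔Bool)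
open import Data.Fin.Subset using (Subset; ∣_∣) renaming (_∈_ to _∈ˢ_)
open import Data.Bool using (Bool; true; false; if_then_else_; _∨_; _∧_)
open import Data.Bool.Properties using (∨-zeroʳ)
open import Data.Vec as Vec using (Vec; []; _∷_)
import Data.Vec.Properties as Vecₚ
open import Data.Maybe as Maybe using (Maybe; just; nothing)
open import Data.List as List using (List; []; _∷_; _++_; map; concatMap; allFin; length; filter)
import Data.List.Properties as Listₚ
open import Data.List.Membership.Propositional using (_∈_; _∉_; find; lose)
import Data.List.Membership.DecPropositional as DecMembership
open import Data.List.Membership.Propositional.Properties
open import Data.List.Relation.Unary.All as All using (All; []; _∷_)
import Data.List.Relation.Unary.All.Properties as Allₚ
open import Data.List.Relation.Unary.Any using (here; there)
open import Data.List.Relation.Unary.Unique.Propositional using (Unique; []; _∷_)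
import Data.List.Relation.Unary.Unique.Propositional.Properties as Uniqueₚ
open import Data.List.Relation.Binary.Permutation.Propositional
  using (_↭_; ↭-refl; ↭-sym; ↭-trans; ↭⇒↭ₛ; prep; swap)
import Data.List.Relation.Binary.Permutation.Propositional.Properties as ↭ₚ
import Data.List.Relation.Binary.Permutation.Setoid.Properties as ↭ₛₚ
open import Data.Product as Product using (Σ; ∃; ∃₂; _×_; _,_; proj₁; proj₂)
open import Data.Sum as Sum using (_⊎_; inj₁; inj₂)
open import Data.Empty using (⊥)
open import Data.Unit using (⊤; tt)
open import Function using (_∘_; id)
open import Function.Bundles using (mk⇔; module Equivalence; module Inverse)
open import Relation.Binary.PropositionalEquality
  using (_≡_; _≢_; refl; sym; trans; cong; cong₂; subst; subst₂; setoid; module ≡-Reasoning)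
open import Relation.Nullary using (¬_; Dec; yes; no; does; contradiction)
open import Relation.Nullary.Decidable using (dec-true)

private variable
  n : ℕ
  X : Set

_∈?_ : (u : Fin n) (xs : List (Fin n)) → Dec (u ∈ xs)
_∈?_ = DecMembership._∈?_ Fin._≟_

Edge : ℕ → Set
Edge n = Fin n × Fin n

-- Sums over lists

sumOf : (X → ℕ) → List X → ℕ
sumOf f xs = sum (map f xs)

bit : Bool → ℕ
bit b = if b then 1 else 0

sumOf-+ : (f g : X → ℕ) (xs : List X) → sumOf (λ x → f x + g x) xs ≡ sumOf f xs + sumOf g xs
sumOf-+ f g [] = refl
sumOf-+ f g (x ∷ xs) = trans (cong (f x + g x +_) (sumOf-+ f g xs))
  (solve 4 (λ a b c d → a :+ b :+ (c :+ d) := a :+ c :+ (b :+ d)) refl (f x) (g x) _ _)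
  where open +-*-Solver

sumOf-mono : {f g : X → ℕ} → (∀ x → f x ≤ g x) → (xs : List X) → sumOf f xs ≤ sumOf g xs
sumOf-mono f≤g [] = z≤n
sumOf-mono f≤g (x ∷ xs) = +-mono-≤ (f≤g x) (sumOf-mono f≤g xs)

-- Each counted entry is cut out of `ys`; since `xs` has no repetitions, its later entries survive
-- the cut.
sumOf-⊆ : (f : X → ℕ) {xs ys : List X} → Unique xs → (∀ {x} → x ∈ xs → x ∈ ys) →
          sumOf f xs ≤ sumOf f ys
sumOf-⊆ f [] xs⊆ys = z≤n
sumOf-⊆ f {x ∷ xs} (x∉xs ∷ uniq) xs⊆ys with ∈-∃++ (xs⊆ys (here refl))
... | as , bs , refl = begin
  f x + sumOf f xs         ≤⟨ +-monoʳ-≤ (f x) (sumOf-⊆ f uniq xs⊆rest) ⟩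
  f x + sumOf f (as ++ bs) ≡⟨ sum-↭ (↭ₚ.map⁺ f (↭ₚ.shift x as bs)) ⟨
  sumOf f (as ++ x ∷ bs)   ∎
  where
  open ≤-Reasoning
  xs⊆rest : ∀ {y} → y ∈ xs → y ∈ as ++ bs
  xs⊆rest y∈xs with ↭ₚ.∈-resp-↭ (↭ₚ.shift x as bs) (xs⊆ys (there y∈xs))
  ... | here refl = contradiction refl (All.lookup x∉xs y∈xs)
  ... | there y∈  = y∈

length≡sumOf-1 : (xs : List X) → length xs ≡ sumOf (λ _ → 1) xs
length≡sumOf-1 [] = refl
length≡sumOf-1 (x ∷ xs) = cong suc (length≡sumOf-1 xs)

module _ {P : X → Set} (P? : ∀ x → Dec (P x)) where

  sumOf-filter : (f : X → ℕ) (xs : List X) →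
                 sumOf f (filter P? xs) ≡ sumOf (λ x → bit (does (P? x)) * f x) xs
  sumOf-filter f [] = refl
  sumOf-filter f (x ∷ xs) with does (P? x)
  ... | true  = cong₂ _+_ (sym (+-identityʳ (f x))) (sumOf-filter f xs)
  ... | false = sumOf-filter f xs

  length-filter-≡ : (xs : List X) → length (filter P? xs) ≡ sumOf (bit ∘ does ∘ P?) xs
  length-filter-≡ [] = refl
  length-filter-≡ (x ∷ xs) with does (P? x)
  ... | true  = cong suc (length-filter-≡ xs)
  ... | false = length-filter-≡ xs

∣tabulate∣ : (f : Fin n → Bool) → ∣ Vec.tabulate f ∣ ≡ sum (List.tabulate (bit ∘ f))
∣tabulate∣ {zero}  f = refl
∣tabulate∣ {suc n} f with f zero
... | true  = cong suc (∣tabulate∣ (f ∘ suc))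
... | false = ∣tabulate∣ (f ∘ suc)

∣tabulate∣-allFin : (f : Fin n → Bool) → ∣ Vec.tabulate f ∣ ≡ sumOf (bit ∘ f) (allFin n)
∣tabulate∣-allFin f = trans (∣tabulate∣ f) (cong sum (sym (Listₚ.map-tabulate id (bit ∘ f))))

∣∣≡sumOf : (S : Subset n) → ∣ S ∣ ≡ sumOf (bit ∘ Vec.lookup S) (allFin n)
∣∣≡sumOf S = trans (cong ∣_∣ (sym (Vecₚ.tabulate∘lookup S))) (∣tabulate∣-allFin (Vec.lookup S))

-- Positions in a list of vertices

-- The length of the list if the vertex does not occur.
position : List (Fin n) → Fin n → ℕ
position [] u = 0
position (h ∷ hs) u = if does (h Fin.≟ u) then 0 else suc (position hs u)

position-< : {hs : List (Fin n)} {u : Fin n} → u ∈ hs → position hs u < length hs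
position-< {hs = h ∷ hs} {u} u∈ with h Fin.≟ u | u∈
... | yes _   | _         = s≤s z≤n
... | no _    | there u∈' = s≤s (position-< u∈')
... | no h≢u  | here refl = contradiction refl h≢u

lookup-position : {hs : List (Fin n)} {u : Fin n} → u ∈ hs → (i : Fin (length hs)) →
                  toℕ i ≡ position hs u → List.lookup hs i ≡ u
lookup-position {hs = h ∷ hs} {u} u∈ i eq with h Fin.≟ u | u∈ | i
... | yes h≡u | _         | zero  = h≡u
... | no _    | there u∈' | suc j = lookup-position u∈' j (suc-injective eq)
... | no h≢u  | here refl | _     = contradiction refl h≢u

position-injective : {hs : List (Fin n)} {u v : Fin n} → u ∈ hs → v ∈ hs →
                     position hs u ≡ position hs v → u ≡ v
position-injective u∈ v∈ eq = trans
  (sym (lookup-position u∈ (fromℕ< (position-< u∈)) (toℕ-fromℕ< _)))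
  (lookup-position v∈ (fromℕ< (position-< u∈)) (trans (toℕ-fromℕ< _) eq))

-- Total lookup, so that `position` can serve as an index without a membership proof. Out of range
-- counts as not selected.
at : {m : ℕ} → Subset m → ℕ → Bool
at []      _       = false
at (b ∷ S) zero    = b
at (b ∷ S) (suc i) = at S i

at-toℕ : {m : ℕ} (S : Subset m) (i : Fin m) → at S (toℕ i) ≡ Vec.lookup S i
at-toℕ (b ∷ S) zero    = refl
at-toℕ (b ∷ S) (suc i) = at-toℕ S i

sumOf-at-position : (hs : List (Fin n)) → Unique hs → (S : Subset (length hs)) →
                    sumOf (bit ∘ at S ∘ position hs) hs ≡ ∣ S ∣
sumOf-at-position [] _ [] = refl
sumOf-at-position (h ∷ hs) (h∉ ∷ uniq) (b ∷ S) =
  trans (cong₂ _+_ at-head (trans (cong sum (Listₚ.map-cong-local (All.map at-tail h∉)))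
                                  (sumOf-at-position hs uniq S)))
        (bit-+ b)
  where
  f = bit ∘ at (b ∷ S) ∘ position (h ∷ hs)
  at-head : f h ≡ bit b
  at-head with h Fin.≟ h
  ... | yes _  = refl
  ... | no h≢h = contradiction refl h≢h
  at-tail : ∀ {u} → h ≢ u → f u ≡ bit (at S (position hs u))
  at-tail {u} h≢u with h Fin.≟ u
  ... | yes h≡u = contradiction h≡u h≢u
  ... | no _    = refl
  bit-+ : ∀ b → bit b + ∣ S ∣ ≡ ∣ b ∷ S ∣
  bit-+ true  = refl
  bit-+ false = refl

-- Weak duality and the Nemhauser–Trotter kernel

-- An edge (u , v) of M joins the left copy of u to the right copy of v in the double cover of G.
record IsMatching (G : Graph n) (M : List (Edge n)) : Set where
  constructor mkMatching
  field
    edges        : All (λ e → Adj G (proj₁ e) (proj₂ e)) M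
    uniqueLefts  : Unique (map proj₁ M)
    uniqueRights : Unique (map proj₂ M)

-- Weights are doubled: 0, 1, 2 stand for 0, 1/2, 1.
HalfCover : Graph n → (Fin n → ℕ) → Set
HalfCover G z = ∀ {u v} → Adj G u v → 2 ≤ z u + z v

-- Sum the cover inequality over `M`. Every vertex is a left end at most once and a right end at
-- most once, so the total weight is counted at most twice.
weakDuality : {G : Graph n} {M : List (Edge n)} {z : Fin n → ℕ} →
              IsMatching G M → HalfCover G z → length M ≤ sumOf z (allFin n)
weakDuality {n = n} {G} {M} {z} (mkMatching adj uniqL uniqR) cover = *-cancelˡ-≤ 2 (begin
  2 * length M                                        ≤⟨ lower M adj ⟩
  sumOf (λ e → z (proj₁ e) + z (proj₂ e)) M           ≡⟨ sumOf-+ (z ∘ proj₁) (z ∘ proj₂) M ⟩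
  sumOf (z ∘ proj₁) M + sumOf (z ∘ proj₂) M           ≡⟨ cong₂ _+_ (cong sum (Listₚ.map-∘ M)) (cong sum (Listₚ.map-∘ M)) ⟩
  sumOf z (map proj₁ M) + sumOf z (map proj₂ M)       ≤⟨ +-mono-≤ (bound uniqL) (bound uniqR) ⟩
  sumOf z (allFin n) + sumOf z (allFin n)             ≡⟨ cong (sumOf z (allFin n) +_) (+-identityʳ _) ⟨
  2 * sumOf z (allFin n)                              ∎)
  where
  open ≤-Reasoning
  lower : ∀ N → All (λ e → Adj G (proj₁ e) (proj₂ e)) N →
          2 * length N ≤ sumOf (λ e → z (proj₁ e) + z (proj₂ e)) N
  lower [] [] = z≤n
  lower (e ∷ N) (a ∷ as) = begin
    2 * suc (length N) ≡⟨ *-suc 2 (length N) ⟩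
    2 + 2 * length N   ≤⟨ +-mono-≤ (cover a) (lower N as) ⟩
    _                  ∎
  bound : ∀ {xs} → Unique xs → sumOf z xs ≤ sumOf z (allFin n)
  bound uniq = sumOf-⊆ z uniq (λ _ → ∈-allFin _)

χ : Subset n → Fin n → ℕ
χ S = bit ∘ Vec.lookup S

cover⇒χ : {E : Fin n → Fin n → Set} {S : Subset n} → IsVertexCover E S →
          ∀ {u v} → E u v → 1 ≤ χ S u + χ S v
cover⇒χ {S = S} cover {u} {v} e with cover u v e
... | inj₁ u∈S rewrite Vecₚ.[]=⇒lookup u∈S = s≤s z≤n
... | inj₂ v∈S rewrite Vecₚ.[]=⇒lookup v∈S = m≤n+m 1 (χ S u)

-- The doubled characteristic function of a cover S of size ≤ k is a half-integral cover of weight ≤ 2k.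
matching-≤ : {G : Graph n} {M : List (Edge n)} {k : ℕ} →
             IsMatching G M → HasVCAtMost (Adj G) k → length M ≤ 2 * k
matching-≤ {n = n} {G} {M} {k} matching (S , ∣S∣≤k , cover) = begin
  length M                                         ≤⟨ weakDuality matching halfCover ⟩
  sumOf (λ u → χ S u + χ S u) (allFin n)           ≡⟨ sumOf-+ (χ S) (χ S) (allFin n) ⟩
  sumOf (χ S) (allFin n) + sumOf (χ S) (allFin n)  ≡⟨ cong₂ _+_ (∣∣≡sumOf S) (∣∣≡sumOf S) ⟨
  ∣ S ∣ + ∣ S ∣                                    ≤⟨ +-mono-≤ ∣S∣≤k ∣S∣≤k ⟩
  k + k                                            ≡⟨ cong (k +_) (+-identityʳ k) ⟨
  2 * k                                            ∎
  where
  open ≤-Reasoning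
  open +-*-Solver
  halfCover : HalfCover G (λ u → χ S u + χ S u)
  halfCover {u} {v} a = begin
    2                                     ≤⟨ *-monoʳ-≤ 2 (cover⇒χ cover a) ⟩
    2 * (χ S u + χ S v)                   ≡⟨ solve 2 (λ a b → con 2 :* (a :+ b) := a :+ a :+ (b :+ b)) refl (χ S u) (χ S v) ⟩
    χ S u + χ S u + (χ S v + χ S v)       ∎

-- Common ground of the two stream models: edges may repeat and come in either orientation.
record IsEdgeList (G : Graph n) (es : List (Edge n)) : Set where
  field
    sound    : ∀ {u v} → (u , v) ∈ es → Adj G u v
    complete : ∀ {u v} → Adj G u v → (u , v) ∈ es ⊎ (v , u) ∈ es

-- Moves the weight 0 up to 1/2 on a cover S and 1 down to 1/2 outside it,
-- where s is the characteristic function of S.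
exchange : ℕ → ℕ → ℕ
exchange 0             s = s
exchange 1             s = 1
exchange (suc (suc _)) s = suc s

-- A vertex of weight 0 has only neighbours of weight at least 2, where the new sum is `s + t + 1`
-- and the cover supplies `1 ≤ s + t`. In all other cases both ends keep at least 1.
exchange-cover : ∀ a b s t → 2 ≤ a + b → 1 ≤ s + t → 2 ≤ exchange a s + exchange b t
exchange-cover 0 (suc (suc b)) s t _ 1≤ = ≤-trans (s≤s 1≤) (≤-reflexive (sym (+-suc s t)))
exchange-cover 1 1 s t _ _ = ≤-refl
exchange-cover 1 (suc (suc b)) s t _ _ = s≤s (s≤s z≤n)
exchange-cover (suc (suc a)) 0 s t _ 1≤ = s≤s 1≤
exchange-cover (suc (suc a)) 1 s t _ _ = s≤s (m≤n+m 1 s)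
exchange-cover (suc (suc a)) (suc (suc b)) s t _ _ = s≤s (≤-trans (s≤s z≤n) (m≤n+m (suc t) s))
exchange-cover 0 0 _ _ () _
exchange-cover 0 1 _ _ (s≤s ()) _
exchange-cover 1 0 _ _ (s≤s ()) _

-- Pointwise form of the count behind Nemhauser-Trotter: summed over all vertices it compares the
-- exchanged weights, plus `full`, plus the part of `S` in `half`, with `y` plus `S`.
exchange-weight : ∀ a s →
  exchange a s + (bit (does (2 ≤? a)) + bit (does (a ≟ 1)) * s) ≤ a + s
exchange-weight 0             s = ≤-reflexive (+-identityʳ s)
exchange-weight 1             s = s≤s (≤-reflexive (+-identityʳ s))
exchange-weight (suc (suc a)) s = s≤s (begin
  s + 1       ≡⟨ +-comm s 1 ⟩
  suc s       ≤⟨ s≤s (m≤n+m s a) ⟩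
  suc (a + s) ∎)
  where open ≤-Reasoning

-- The kernel given by half-integral weights

module Kernel (y : Fin n → ℕ) where

  half full : List (Fin n)
  half = filter (λ u → y u ≟ 1) (allFin n)
  full = filter (λ u → 2 ≤? y u) (allFin n)

  -- Depends on the weights alone, so a kernel edge is emitted as soon as its edge is read and is
  -- never stored.
  kernelEdge : Edge n → List (ℕ × ℕ)
  kernelEdge (u , v) with y u ≟ 1 | y v ≟ 1
  ... | yes _ | yes _ = (position half u , position half v) ∷ []
  ... | _     | _     = []

  ∈-half : ∀ {u} → y u ≡ 1 → u ∈ half
  ∈-half = ∈-filter⁺ (λ u → y u ≟ 1) (∈-allFin _)

  data KernelEdge (u v : Fin n) : ℕ × ℕ → Set where
    both : u ∈ half → v ∈ half → KernelEdge u v (position half u , position half v)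

  kernelEdge⁻ : ∀ u v {e} → e ∈ kernelEdge (u , v) → KernelEdge u v e
  kernelEdge⁻ u v e∈ with y u ≟ 1 | y v ≟ 1 | e∈
  ... | yes yu | yes yv | here refl = both (∈-half yu) (∈-half yv)

  kernelEdge⁺ : ∀ {u v} → y u ≡ 1 → y v ≡ 1 →
                (position half u , position half v) ∈ kernelEdge (u , v)
  kernelEdge⁺ {u} {v} yu yv with y u ≟ 1 | y v ≟ 1
  ... | yes _  | yes _  = here refl
  ... | no ¬yu | _      = contradiction yu ¬yu
  ... | yes _  | no ¬yv = contradiction yv ¬yv

  length-half+full : length half + 2 * length full ≤ sumOf y (allFin n)
  length-half+full = begin
    length half + 2 * length full  ≡⟨ cong (length half +_) (cong (length full +_) (+-identityʳ _)) ⟩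
    length half + (length full + length full)
      ≡⟨ cong₂ _+_ (length-filter-≡ (λ u → y u ≟ 1) (allFin n)) (cong₂ _+_ lf lf) ⟩
    sumOf h (allFin n) + (sumOf f (allFin n) + sumOf f (allFin n))
      ≡⟨ cong (sumOf h (allFin n) +_) (sumOf-+ f f (allFin n)) ⟨
    sumOf h (allFin n) + sumOf (λ u → f u + f u) (allFin n)
      ≡⟨ sumOf-+ h (λ u → f u + f u) (allFin n) ⟨
    sumOf (λ u → h u + (f u + f u)) (allFin n)
      ≤⟨ sumOf-mono (λ u → pointwise (y u)) (allFin n) ⟩
    sumOf y (allFin n) ∎
    where
    open ≤-Reasoning
    h f : Fin n → ℕ
    h u = bit (does (y u ≟ 1))
    f u = bit (does (2 ≤? y u))
    lf : length full ≡ sumOf f (allFin n)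
    lf = length-filter-≡ (λ u → 2 ≤? y u) (allFin n)
    pointwise : ∀ a → bit (does (a ≟ 1)) + (bit (does (2 ≤? a)) + bit (does (2 ≤? a))) ≤ a
    pointwise 0             = z≤n
    pointwise 1             = ≤-refl
    pointwise (suc (suc a)) = s≤s (s≤s z≤n)

  kernelOutput : ℕ → List OutTok
  kernelOutput k = size (length half) ∷ param (k ∸ length full) ∷ []

  edgeTok : ℕ × ℕ → OutTok
  edgeTok e = edge (proj₁ e) (proj₂ e)

  module _ {G : Graph n} {M : List (Edge n)} {k : ℕ} {es : List (Edge n)}
           (matching : IsMatching G M) (cover : HalfCover G y)
           (tight : sumOf y (allFin n) ≤ length M) (small : length M ≤ 2 * k)
           (isEdges : IsEdgeList G es) where

    open IsEdgeList isEdges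

    private
      m k' : ℕ
      m  = length half
      k' = k ∸ length full
      kes : List (ℕ × ℕ)
      kes = concatMap kernelEdge es

    kernelEdges⁻ : ∀ {e} → e ∈ kes → ∃₂ λ u v → (u , v) ∈ es × KernelEdge u v e
    kernelEdges⁻ e∈ with ∈-concatMap⁻ kernelEdge {xs = es} e∈
    ... | any with find any
    ... | (u , v) , uv∈ , e∈' = u , v , uv∈ , kernelEdge⁻ u v e∈'

    kernelEdges⁺ : ∀ {u v} → (u , v) ∈ es → y u ≡ 1 → y v ≡ 1 →
                   (position half u , position half v) ∈ kes
    kernelEdges⁺ uv∈ yu yv = ∈-concatMap⁺ kernelEdge (lose uv∈ (kernelEdge⁺ yu yv))

    full≤k : length full ≤ k
    full≤k = *-cancelˡ-≤ 2 (≤-trans (m≤n+m _ (length half))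
               (≤-trans length-half+full (≤-trans tight small)))

    half≤2k : length half ≤ 2 * k
    half≤2k = ≤-trans (m≤m+n (length half) _)
                (≤-trans length-half+full (≤-trans tight small))

    kes-valid : All (λ e → proj₁ e < m × proj₂ e < m × proj₁ e ≢ proj₂ e) kes
    kes-valid = All.tabulate λ e∈ → valid (kernelEdges⁻ e∈)
      where
      valid : ∀ {e} → (∃₂ λ u v → (u , v) ∈ es × KernelEdge u v e) →
              proj₁ e < m × proj₂ e < m × proj₁ e ≢ proj₂ e
      valid (u , v , uv∈ , both u∈ v∈) = position-< u∈ , position-< v∈ ,
        λ eq → irrefl G (subst (Adj G u) (sym (position-injective u∈ v∈ eq)) (sound uv∈))

    -- The trace of `S` on `half` covers the kernel. Its size drops enough because an exchange along
    -- `S` cannot beat the optimal weights `y`.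
    restrict : HasVCAtMost (Adj G) k → HasVCAtMost (KAdj m kes) k'
    restrict (S , ∣S∣≤k , S-cover) = S' , ∣S'∣≤k' , S'-cover
      where
      S' : Subset m
      S' = Vec.tabulate (Vec.lookup S ∘ List.lookup half)

      f h z : Fin n → ℕ
      f u = bit (does (2 ≤? y u))
      h u = bit (does (y u ≟ 1)) * χ S u
      z u = exchange (y u) (χ S u)

      ∣S'∣≡ : ∣ S' ∣ ≡ sumOf h (allFin n)
      ∣S'∣≡ = begin
        ∣ S' ∣                                                ≡⟨ ∣tabulate∣ (Vec.lookup S ∘ List.lookup half) ⟩
        sum (List.tabulate (χ S ∘ List.lookup half))          ≡⟨ cong sum (Listₚ.map-tabulate (List.lookup half) (χ S)) ⟨
        sumOf (χ S) (List.tabulate (List.lookup half))        ≡⟨ cong (sumOf (χ S)) (Listₚ.tabulate-lookup half) ⟩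
        sumOf (χ S) half                                      ≡⟨ sumOf-filter (λ u → y u ≟ 1) (χ S) (allFin n) ⟩
        sumOf h (allFin n)                                    ∎
        where open ≡-Reasoning

      -- Σ z ≥ |M| ≥ Σ y by weak duality, so the weight gained on S is at least the weight lost.
      full+S' : length full + ∣ S' ∣ ≤ ∣ S ∣
      full+S' = +-cancelˡ-≤ (sumOf y (allFin n)) _ _ (begin
        sumOf y (allFin n) + (length full + ∣ S' ∣)
          ≤⟨ +-monoˡ-≤ _ (≤-trans tight (weakDuality matching z-cover)) ⟩
        sumOf z (allFin n) + (length full + ∣ S' ∣)
          ≡⟨ cong (sumOf z (allFin n) +_) (cong₂ _+_ (length-filter-≡ (λ u → 2 ≤? y u) (allFin n)) ∣S'∣≡) ⟩
        sumOf z (allFin n) + (sumOf f (allFin n) + sumOf h (allFin n))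
          ≡⟨ cong (sumOf z (allFin n) +_) (sumOf-+ f h (allFin n)) ⟨
        sumOf z (allFin n) + sumOf (λ u → f u + h u) (allFin n)
          ≡⟨ sumOf-+ z (λ u → f u + h u) (allFin n) ⟨
        sumOf (λ u → z u + (f u + h u)) (allFin n)
          ≤⟨ sumOf-mono (λ u → exchange-weight (y u) (χ S u)) (allFin n) ⟩
        sumOf (λ u → y u + χ S u) (allFin n)
          ≡⟨ sumOf-+ y (χ S) (allFin n) ⟩
        sumOf y (allFin n) + sumOf (χ S) (allFin n)
          ≡⟨ cong (sumOf y (allFin n) +_) (∣∣≡sumOf S) ⟨
        sumOf y (allFin n) + ∣ S ∣ ∎)
        where
        open ≤-Reasoning
        z-cover : HalfCover G z
        z-cover {u} {v} a = exchange-cover (y u) (y v) (χ S u) (χ S v) (cover a) (cover⇒χ S-cover a)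

      ∣S'∣≤k' : ∣ S' ∣ ≤ k'
      ∣S'∣≤k' = m+n≤o⇒m≤o∸n ∣ S' ∣
        (≤-trans (≤-reflexive (+-comm ∣ S' ∣ (length full))) (≤-trans full+S' ∣S∣≤k))

      ∈S' : ∀ {u} i → u ∈ half → toℕ i ≡ position half u → u ∈ˢ S → i ∈ˢ S'
      ∈S' i u∈ eq u∈S = Vecₚ.lookup⇒[]= i S' (trans
        (Vecₚ.lookup∘tabulate _ i)
        (trans (cong (Vec.lookup S) (lookup-position u∈ i eq)) (Vecₚ.[]=⇒lookup u∈S)))

      covers : ∀ i j → (toℕ i , toℕ j) ∈ kes → i ∈ˢ S' ⊎ j ∈ˢ S'
      covers i j e∈ = go refl refl (kernelEdges⁻ e∈)
        where
        -- The indices are generalised to `a` and `b` with equations, since `toℕ i` does not unify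
        -- with `position half u`.
        go : ∀ {a b} → toℕ i ≡ a → toℕ j ≡ b →
             (∃₂ λ u v → (u , v) ∈ es × KernelEdge u v (a , b)) → i ∈ˢ S' ⊎ j ∈ˢ S'
        go ia jb (u , v , uv∈ , both u∈ v∈) =
          Sum.map (∈S' i u∈ ia) (∈S' j v∈ jb) (S-cover u v (sound uv∈))

      S'-cover : IsVertexCover (KAdj m kes) S'
      S'-cover i j (inj₁ e∈) = covers i j e∈
      S'-cover i j (inj₂ e∈) = Sum.swap (covers j i e∈)

    -- All of `full` is added to the kernel cover. An edge missed by `full` has both ends of weight
    -- 1, hence is a kernel edge.
    extend : HasVCAtMost (KAdj m kes) k' → HasVCAtMost (Adj G) k
    extend (S' , ∣S'∣≤k' , S'-cover) = S , ∣S∣≤k , S-cover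
      where
      inS : Fin n → Bool
      inS u = does (2 ≤? y u) ∨ (does (y u ≟ 1) ∧ at S' (position half u))

      S : Subset n
      S = Vec.tabulate inS

      f h : Fin n → ℕ
      f u = bit (does (2 ≤? y u))
      h u = bit (does (y u ≟ 1)) * bit (at S' (position half u))

      bit-≤ : ∀ a b c → bit (a ∨ (b ∧ c)) ≤ bit a + bit b * bit c
      bit-≤ true  b     c = s≤s z≤n
      bit-≤ false false c = z≤n
      bit-≤ false true  c = m≤m+n (bit c) 0

      uniqueHalf : Unique half
      uniqueHalf = Uniqueₚ.filter⁺ (λ u → y u ≟ 1) (Uniqueₚ.allFin⁺ n)

      ∣S∣≤k : ∣ S ∣ ≤ k
      ∣S∣≤k = begin
        ∣ S ∣                                    ≡⟨ ∣tabulate∣-allFin inS ⟩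
        sumOf (bit ∘ inS) (allFin n)             ≤⟨ sumOf-mono (λ u → bit-≤ (does (2 ≤? y u))
                                                      (does (y u ≟ 1)) (at S' (position half u))) (allFin n) ⟩
        sumOf (λ u → f u + h u) (allFin n)       ≡⟨ sumOf-+ f h (allFin n) ⟩
        sumOf f (allFin n) + sumOf h (allFin n)
          ≡⟨ cong₂ _+_ (length-filter-≡ (λ u → 2 ≤? y u) (allFin n))
                       (sumOf-filter (λ u → y u ≟ 1) (bit ∘ at S' ∘ position half) (allFin n)) ⟨
        length full + sumOf (bit ∘ at S' ∘ position half) half
          ≡⟨ cong (length full +_) (sumOf-at-position half uniqueHalf S') ⟩
        length full + ∣ S' ∣                     ≤⟨ +-monoʳ-≤ (length full) ∣S'∣≤k' ⟩
        length full + (k ∸ length full)          ≡⟨ m+[n∸m]≡n full≤k ⟩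
        k                                        ∎
        where open ≤-Reasoning

      inS⇒∈ : ∀ {u} → inS u ≡ true → u ∈ˢ S
      inS⇒∈ {u} eq = Vecₚ.lookup⇒[]= u S (trans (Vecₚ.lookup∘tabulate inS u) eq)

      full⇒∈ : ∀ {u} → 2 ≤ y u → u ∈ˢ S
      full⇒∈ {u} 2≤ = inS⇒∈
        (cong (_∨ (does (y u ≟ 1) ∧ at S' (position half u))) (dec-true (2 ≤? y u) 2≤))

      half⇒∈ : ∀ {u} → y u ≡ 1 → at S' (position half u) ≡ true → u ∈ˢ S
      half⇒∈ {u} yu in' = inS⇒∈ (trans
        (cong (does (2 ≤? y u) ∨_) (cong₂ _∧_ (dec-true (y u ≟ 1) yu) in'))
        (∨-zeroʳ _))

      half-cover : ∀ {u v} → Adj G u v → y u ≡ 1 → y v ≡ 1 → u ∈ˢ S ⊎ v ∈ˢ S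
      half-cover {u} {v} a yu yv = Sum.map (lift yu) (lift yv) (S'-cover i j ij)
        where
        index : ∀ {w} → y w ≡ 1 → Fin m
        index yw = fromℕ< (position-< (∈-half yw))
        i = index yu
        j = index yv
        lift : ∀ {w} (yw : y w ≡ 1) → index yw ∈ˢ S' → w ∈ˢ S
        lift {w} yw w∈ = half⇒∈ yw (begin
          at S' (position half w)   ≡⟨ cong (at S') (toℕ-fromℕ< (position-< (∈-half yw))) ⟨
          at S' (toℕ (index yw))    ≡⟨ at-toℕ S' (index yw) ⟩
          Vec.lookup S' (index yw)  ≡⟨ Vecₚ.[]=⇒lookup w∈ ⟩
          true                      ∎)
          where open ≡-Reasoning
        ij : KAdj m kes i j
        ij = subst₂ (λ a b → ((a , b) ∈ kes) ⊎ ((b , a) ∈ kes))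
          (sym (toℕ-fromℕ< (position-< (∈-half yu)))) (sym (toℕ-fromℕ< (position-< (∈-half yv))))
          (Sum.map (λ uv∈ → kernelEdges⁺ uv∈ yu yv) (λ vu∈ → kernelEdges⁺ vu∈ yv yu) (complete a))

      split-cover : ∀ a b → 2 ≤ a + b → 2 ≤ a ⊎ 2 ≤ b ⊎ (a ≡ 1 × b ≡ 1)
      split-cover 0 b 2≤ = inj₂ (inj₁ 2≤)
      split-cover 1 0 (s≤s ())
      split-cover 1 1 _ = inj₂ (inj₂ (refl , refl))
      split-cover 1 (suc (suc b)) _ = inj₂ (inj₁ (s≤s (s≤s z≤n)))
      split-cover (suc (suc a)) b _ = inj₁ (s≤s (s≤s z≤n))

      S-cover : IsVertexCover (Adj G) S
      S-cover u v a with split-cover (y u) (y v) (cover a)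
      ... | inj₁ 2≤yu               = inj₁ (full⇒∈ 2≤yu)
      ... | inj₂ (inj₁ 2≤yv)        = inj₂ (full⇒∈ 2≤yv)
      ... | inj₂ (inj₂ (yu , yv))   = half-cover a yu yv

    kernelOutput-valid : ValidKernelOutput G k (map edgeTok kes ++ kernelOutput k)
    kernelOutput-valid = inj₂ (m , k' , kes , ↭ₚ.++-comm (map edgeTok kes) (kernelOutput k) ,
      half≤2k , m∸n≤m k (length full) , kes-valid , mk⇔ restrict extend)

-- Augmenting paths in the bipartite double cover

lefts rights : List (Edge n) → List (Fin n)
lefts  = map proj₁
rights = map proj₂

-- A matched edge (a , w) whose right endpoint w is reachable by an alternating
-- path, together with the left vertex p from which w was reached.
Mark : ℕ → Set
Mark n = Edge n × Fin n

matched : List (Mark n) → List (Edge n) → List (Edge n)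
matched ms us = map proj₁ ms ++ us

-- Every mark (with parent p) is preceded in time, hence followed in the list,
-- by the mark of the edge matching p, unless p is unmatched.
Chain : Graph n → List (Fin n) → List (Mark n) → Set
Chain G used []                   = ⊤
Chain G used (((a , w) , p) ∷ ms) =
  Adj G p w × (p ∈ lefts (map proj₁ ms) ⊎ p ∉ used) × Chain G used ms

Chain-map : {G : Graph n} {used used' : List (Fin n)} → (∀ {p} → p ∉ used → p ∉ used') →
            (ms : List (Mark n)) → Chain G used ms → Chain G used' ms
Chain-map free [] _ = _
Chain-map free (_ ∷ ms) (pw , reach , chain) = pw , Sum.map₂ free reach , Chain-map free ms chain

-- Flips the alternating path that ends with the edge e, following parents.
augment : List (Mark n) → Edge n → List (Edge n)
augment [] e = e ∷ []
augment (((a , w) , p) ∷ ms) (u , v) with a Fin.≟ u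
-- The path runs through `a`: it is rematched to `v`, and its former partner `w` is handed to the
-- parent `p`.
... | yes _ = (a , v) ∷ augment ms (p , w)
... | no _  = (a , w) ∷ augment ms (u , v)

length-augment : (ms : List (Mark n)) (e : Edge n) → length (augment ms e) ≡ suc (length ms)
length-augment [] e = refl
length-augment (((a , w) , p) ∷ ms) (u , v) with a Fin.≟ u
... | yes _ = cong suc (length-augment ms (p , w))
... | no _  = cong suc (length-augment ms (u , v))

-- Each flip passes the freed right end on to the next edge, so only `v` is new.
rights-augment : (ms : List (Mark n)) (u v : Fin n) →
                 rights (augment ms (u , v)) ↭ v ∷ rights (map proj₁ ms)
rights-augment [] u v = ↭-refl
rights-augment (((a , w) , p) ∷ ms) u v with a Fin.≟ u
... | yes _ = prep v (rights-augment ms p w)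
... | no _  = ↭-trans (prep w (rights-augment ms u v)) (swap w v ↭-refl)

-- `r` is the free left vertex where the path starts. Parents lie further down the list or are free,
-- so following them reaches such a vertex.
lefts-augment : {G : Graph n} {used : List (Fin n)} (ms : List (Mark n)) → Chain G used ms →
                ∀ u v → u ∈ lefts (map proj₁ ms) ⊎ u ∉ used →
                ∃ λ r → r ∉ used × lefts (augment ms (u , v)) ↭ r ∷ lefts (map proj₁ ms)
lefts-augment [] _ u v (inj₂ u∉) = u , u∉ , ↭-refl
lefts-augment (((a , w) , p) ∷ ms) (_ , reach , chain) u v u-reach with a Fin.≟ u
... | yes _ with lefts-augment ms chain p w reach
...   | r , r∉ , perm = r , r∉ , ↭-trans (prep a perm) (swap a r ↭-refl)
lefts-augment (((a , w) , p) ∷ ms) (_ , reach , chain) u v u-reach | no a≢u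
  with lefts-augment ms chain u v (later u-reach)
  where
  later : u ∈ a ∷ lefts (map proj₁ ms) ⊎ u ∉ _ → u ∈ lefts (map proj₁ ms) ⊎ u ∉ _
  later (inj₁ (here refl)) = contradiction refl a≢u
  later (inj₁ (there u∈))  = inj₁ u∈
  later (inj₂ u∉)          = inj₂ u∉
... | r , r∉ , perm = r , r∉ , ↭-trans (prep a perm) (swap a r ↭-refl)

edges-augment : {G : Graph n} {used : List (Fin n)} (ms : List (Mark n)) → Chain G used ms →
                All (λ e → Adj G (proj₁ e) (proj₂ e)) (map proj₁ ms) → ∀ {u v} → Adj G u v →
                All (λ e → Adj G (proj₁ e) (proj₂ e)) (augment ms (u , v))
edges-augment [] _ _ uv = uv ∷ []
edges-augment (((a , w) , p) ∷ ms) (pw , _ , chain) (aw ∷ adj) {u} uv with a Fin.≟ u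
... | yes refl = uv ∷ edges-augment ms chain adj pw
... | no _     = aw ∷ edges-augment ms chain adj uv

Unique-resp-↭ : {xs ys : List X} → xs ↭ ys → Unique xs → Unique ys
Unique-resp-↭ p = ↭ₛₚ.Unique-resp-↭ (setoid _) (↭⇒↭ₛ p)

∉-∷ : {x : X} {xs : List X} → x ∉ xs → Unique xs → Unique (x ∷ xs)
∉-∷ x∉ uniq = All.tabulate (λ { y∈ refl → x∉ y∈ }) ∷ uniq

IsMatching-resp-↭ : {G : Graph n} {M N : List (Edge n)} → M ↭ N → IsMatching G M → IsMatching G N
IsMatching-resp-↭ p (mkMatching adj uniqL uniqR) = mkMatching
  (↭ₚ.All-resp-↭ p adj) (Unique-resp-↭ (↭ₚ.map⁺ proj₁ p) uniqL) (Unique-resp-↭ (↭ₚ.map⁺ proj₂ p) uniqR)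

IsMatching-augment : {G : Graph n} (ms : List (Mark n)) (us : List (Edge n)) →
  IsMatching G (matched ms us) → Chain G (lefts (matched ms us)) ms →
  ∀ {u v} → Adj G u v → u ∉ lefts us → v ∉ rights (map proj₁ ms) → v ∉ rights us →
  IsMatching G (augment ms (u , v) ++ us)
IsMatching-augment {n} {G} ms us (mkMatching adj uniqL uniqR) chain {u} {v} uv u∉ v∉ms v∉us =
  mkMatching
    (Allₚ.++⁺ (edges-augment ms chain (Allₚ.++⁻ˡ (map proj₁ ms) adj) uv) (Allₚ.++⁻ʳ (map proj₁ ms) adj))
    (Unique-resp-↭ (↭-sym perm-lefts) (∉-∷ r∉ uniqL))
    (Unique-resp-↭ (↭-sym perm-rights) (∉-∷ v∉ uniqR))
  where
  open ↭ₚ using (++⁺ʳ)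
  lift-perm : (f : Edge n → Fin n) {x : Fin n} →
              map f (augment ms (u , v)) ↭ x ∷ map f (map proj₁ ms) →
              map f (augment ms (u , v) ++ us) ↭ x ∷ map f (matched ms us)
  lift-perm f p = subst₂ _↭_ (sym (Listₚ.map-++ f (augment ms (u , v)) us))
    (cong (_ ∷_) (sym (Listₚ.map-++ f (map proj₁ ms) us))) (++⁺ʳ (map f us) p)

  -- Not being the left end of an unmarked matched edge, `u` is either on a marked edge or free.
  u-reach : u ∈ lefts (map proj₁ ms) ⊎ u ∉ lefts (matched ms us)
  u-reach with u ∈? lefts (map proj₁ ms)
  ... | yes u∈ = inj₁ u∈
  ... | no u∉ms = inj₂ λ u∈ → Sum.[ u∉ms , u∉ ]
          (∈-++⁻ (lefts (map proj₁ ms)) (subst (u ∈_) (Listₚ.map-++ proj₁ (map proj₁ ms) us) u∈))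

  path = lefts-augment ms chain u v u-reach
  r∉ = proj₁ (proj₂ path)
  perm-lefts = lift-perm proj₁ (proj₂ (proj₂ path))
  perm-rights = lift-perm proj₂ (rights-augment ms u v)
  v∉ : v ∉ rights (matched ms us)
  v∉ v∈ = Sum.[ v∉ms , v∉us ]
    (∈-++⁻ (rights (map proj₁ ms)) (subst (v ∈_) (Listₚ.map-++ proj₂ (map proj₁ ms) us) v∈))

extract : (v : Fin n) (us : List (Edge n)) →
          (∃₂ λ a rest → us ↭ (a , v) ∷ rest) ⊎ v ∉ rights us
extract v [] = inj₂ λ ()
extract v ((a , w) ∷ us) with w Fin.≟ v
... | yes refl = inj₁ (a , us , ↭-refl)
... | no w≢v with extract v us
...   | inj₁ (b , rest , p) = inj₁ (b , (a , w) ∷ rest , ↭-trans (prep _ p) (swap _ _ ↭-refl))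
...   | inj₂ v∉ = inj₂ λ { (here refl) → w≢v refl ; (there v∈) → v∉ v∈ }

-- A half-integral cover from an exhausted search

-- The König cover of the double cover: left vertices not reached, right vertices reached.
weight : List (Mark n) → List (Edge n) → Fin n → ℕ
weight ms us u = bit (does (u ∈? lefts us)) + bit (does (u ∈? rights (map proj₁ ms)))

-- A left vertex is unreached exactly when its matched edge is unmarked, so this says that the König
-- cover meets the edge.
Stable : List (Mark n) → List (Edge n) → Edge n → Set
Stable ms us (u , v) = u ∈ lefts us ⊎ v ∈ rights (map proj₁ ms)

-- Both orientations of an edge of `G` lie in the double cover; each contributes 1.
weight-cover : {G : Graph n} (ms : List (Mark n)) (us : List (Edge n)) →
               (∀ {u v} → Adj G u v → Stable ms us (u , v)) → HalfCover G (weight ms us)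
weight-cover {n} {G} ms us stable {u} {v} a = begin
  2                                   ≤⟨ +-mono-≤ (one (stable a)) (one (stable (Graph.sym G a))) ⟩
  L u + R v + (L v + R u)             ≡⟨ solve 4 (λ a b c d → a :+ b :+ (c :+ d) := a :+ d :+ (c :+ b)) refl (L u) (R v) (L v) (R u) ⟩
  L u + R u + (L v + R v)             ∎
  where
  open ≤-Reasoning
  open +-*-Solver
  L R : Fin n → ℕ
  L w = bit (does (w ∈? lefts us))
  R w = bit (does (w ∈? rights (map proj₁ ms)))
  one : ∀ {x y} → Stable ms us (x , y) → 1 ≤ L x + R y
  one {x} (inj₁ x∈) rewrite dec-true (x ∈? lefts us) x∈ = s≤s z≤n
  one {x} {y} (inj₂ y∈) rewrite dec-true (y ∈? rights (map proj₁ ms)) y∈ = m≤n+m 1 (L x)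

sumOf-∈ : (xs : List (Fin n)) → sumOf (λ u → bit (does (u ∈? xs))) (allFin n) ≤ length xs
sumOf-∈ {n} xs = begin
  sumOf (λ u → bit (does (u ∈? xs))) (allFin n)  ≡⟨ length-filter-≡ (_∈? xs) (allFin n) ⟨
  length members                                 ≡⟨ length≡sumOf-1 members ⟩
  sumOf (λ _ → 1) members                        ≤⟨ sumOf-⊆ (λ _ → 1) (Uniqueₚ.filter⁺ (_∈? xs) (Uniqueₚ.allFin⁺ n))
                                                      (λ x∈ → proj₂ (∈-filter⁻ (_∈? xs) {xs = allFin n} x∈)) ⟩
  sumOf (λ _ → 1) xs                             ≡⟨ length≡sumOf-1 xs ⟨
  length xs                                      ∎
  where
  open ≤-Reasoning
  members = filter (_∈? xs) (allFin n)

length-matched : (ms : List (Mark n)) (us : List (Edge n)) →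
                 length (matched ms us) ≡ length ms + length us
length-matched ms us = trans (Listₚ.length-++ (map proj₁ ms)) (cong (_+ length us) (Listₚ.length-map proj₁ ms))

-- Each matched edge pays for one cover vertex: its right end if marked, its left end otherwise.
weight-tight : (ms : List (Mark n)) (us : List (Edge n)) →
               sumOf (weight ms us) (allFin n) ≤ length (matched ms us)
weight-tight {n} ms us = begin
  sumOf (weight ms us) (allFin n)
    ≡⟨ sumOf-+ (λ u → bit (does (u ∈? lefts us))) (λ u → bit (does (u ∈? rights (map proj₁ ms)))) (allFin n) ⟩
  _ ≤⟨ +-mono-≤ (sumOf-∈ (lefts us)) (sumOf-∈ (rights (map proj₁ ms))) ⟩
  length (lefts us) + length (rights (map proj₁ ms))
    ≡⟨ cong₂ _+_ (Listₚ.length-map proj₁ us)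
                  (trans (Listₚ.length-map proj₂ (map proj₁ ms)) (Listₚ.length-map proj₁ ms)) ⟩
  length us + length ms      ≡⟨ +-comm (length us) (length ms) ⟩
  length ms + length us      ≡⟨ length-matched ms us ⟨
  length (matched ms us)     ∎
  where open ≤-Reasoning

-- The streaming algorithm on unencoded states

-- The flag of a search tells whether the current pass has changed the state.
data State (n : ℕ) : Set where
  search : Bool → List (Mark n) → List (Edge n) → State n
  report : List (Mark n) → List (Edge n) → State n
  over   : State n
  done   : State n

module Algorithm {n : ℕ} (k : ℕ) where

  -- For `u` reached and `v` not: a matched `v` gets its edge marked with parent `u`; a free `v`
  -- ends an augmenting path, whose flip discards all marks.
  relax : State n → Edge n → State n
  relax (search c ms us) (u , v) with u ∈? lefts us | v ∈? rights (map proj₁ ms)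
  ... | yes _ | _     = search c ms us
  ... | no _  | yes _ = search c ms us
  ... | no _  | no _ with extract v us
  ...   | inj₁ (a , rest , _) = search true (((a , v) , u) ∷ ms) rest
  -- Memory is reserved for `2 * k` matched edges, and a larger matching already refutes the
  -- instance.
  ...   | inj₂ _ with length (augment ms (u , v) ++ us) ≤? 2 * k
  ...     | yes _ = search true [] (augment ms (u , v) ++ us)
  ...     | no _  = over
  relax s _ = s

  emit : State n → Edge n → List OutTok
  emit (report ms us) e = map edgeTok (kernelEdge e) where open Kernel (weight ms us)
  emit _              e = []

  process : State n → Edge n → State n × List OutTok
  process s e = relax (relax s e) (Product.swap e) , emit s e

  finish : State n → State n × List OutTok
  finish (search true  ms us) = search false ms us , []
  -- The final weights are known only now, so the kernel edges are emitted in one further pass.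
  finish (search false ms us) = report ms us , []
  finish (report ms us)       = done , kernelOutput k where open Kernel (weight ms us)
  finish over                 = done , OutTok.no ∷ []
  finish done                 = done , []

  read : State n → List (Edge n) → State n × List OutTok
  read s []       = s , []
  read s (e ∷ es) = proj₁ rest , proj₂ (process s e) ++ proj₂ rest
    where rest = read (proj₁ (process s e)) es

  pass : State n → List (Edge n) → State n × List OutTok
  pass s es = proj₁ end , proj₂ (read s es) ++ proj₂ end
    where end = finish (proj₁ (read s es))

  run : ℕ → State n → List (Edge n) → State n × List OutTok
  run zero    s es = s , []
  run (suc q) s es = proj₁ rest , proj₂ (pass s es) ++ proj₂ rest
    where rest = run q (proj₁ (pass s es)) es

  -- The condition under which the bit encoding, which truncates long lists, is faithful. It refers
  -- to no graph.
  Bounded : State n → Set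
  Bounded (search _ ms us) = length ms + length us ≤ 2 * k
  Bounded (report ms us)   = length ms + length us ≤ 2 * k
  Bounded over             = ⊤
  Bounded done             = ⊤

  -- The outcomes of `relax` together with the facts its tests establish, so that later proofs avoid
  -- repeating the case analysis.
  data Relaxation (c : Bool) (ms : List (Mark n)) (us : List (Edge n)) (u v : Fin n) : State n → Set where
    stable   : Stable ms us (u , v) → Relaxation c ms us u v (search c ms us)
    mark     : u ∉ lefts us → ∀ {a rest} → us ↭ (a , v) ∷ rest →
               Relaxation c ms us u v (search true (((a , v) , u) ∷ ms) rest)
    enlarge  : u ∉ lefts us → v ∉ rights (map proj₁ ms) → v ∉ rights us →
               length (augment ms (u , v) ++ us) ≤ 2 * k →
               Relaxation c ms us u v (search true [] (augment ms (u , v) ++ us))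
    overflow : u ∉ lefts us → v ∉ rights (map proj₁ ms) → v ∉ rights us →
               ¬ length (augment ms (u , v) ++ us) ≤ 2 * k →
               Relaxation c ms us u v over

  relaxation : ∀ c ms us u v → Relaxation c ms us u v (relax (search c ms us) (u , v))
  relaxation c ms us u v with u ∈? lefts us | v ∈? rights (map proj₁ ms)
  ... | yes u∈ | _      = stable (inj₁ u∈)
  ... | no _   | yes v∈ = stable (inj₂ v∈)
  ... | no u∉  | no v∉ with extract v us
  ...   | inj₁ (a , rest , p) = mark u∉ p
  ...   | inj₂ v∉us with length (augment ms (u , v) ++ us) ≤? 2 * k
  ...     | yes ≤2k = enlarge u∉ v∉ v∉us ≤2k
  ...     | no ≰2k  = overflow u∉ v∉ v∉us ≰2k

  relax-bounded : ∀ s e → Bounded s → Bounded (relax s e)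
  relax-bounded (search c ms us) (u , v) b
    with relax (search c ms us) (u , v) | relaxation c ms us u v
  ... | _ | stable _          = b
  ... | _ | enlarge _ _ _ ≤2k = ≤2k
  ... | _ | overflow _ _ _ _  = _
  ... | _ | mark _ {rest = rest} p = ≤-trans
    (≤-reflexive (trans (sym (+-suc (length ms) (length rest))) (cong (length ms +_) (sym (↭ₚ.↭-length p))))) b
  relax-bounded (report ms us) e b = b
  relax-bounded over e b = b
  relax-bounded done e b = b

  process-bounded : ∀ s e → Bounded s → Bounded (proj₁ (process s e))
  process-bounded s e b = relax-bounded (relax s e) _ (relax-bounded s e b)

  finish-bounded : ∀ s → Bounded s → Bounded (proj₁ (finish s))
  finish-bounded (search true  ms us) b = b
  finish-bounded (search false ms us) b = b
  finish-bounded (report ms us)       b = _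
  finish-bounded over                 b = _
  finish-bounded done                 b = _

  read-bounded : ∀ s es → Bounded s → Bounded (proj₁ (read s es))
  read-bounded s [] b = b
  read-bounded s (e ∷ es) b = read-bounded _ es (process-bounded s e b)

  -- Lexicographic order on matching size and number of marks: the factor exceeds any possible
  -- number of marks.
  potential : List (Mark n) → List (Edge n) → ℕ
  potential ms us = (length ms + length us) * suc (2 * k) + length ms

  potential-< : ∀ ms us → length ms + length us ≤ 2 * k → potential ms us < suc (2 * k) * suc (2 * k)
  potential-< ms us b = begin-strict
    (length ms + length us) * suc (2 * k) + length ms
      <⟨ +-mono-≤-< (*-monoˡ-≤ (suc (2 * k)) b) (s≤s (≤-trans (m≤m+n (length ms) _) b)) ⟩
    2 * k * suc (2 * k) + suc (2 * k)  ≡⟨ +-comm _ (suc (2 * k)) ⟩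
    suc (2 * k) * suc (2 * k)          ∎
    where open ≤-Reasoning

  -- Progress of the search and correctness of its output

  module Correctness (G : Graph n) where

    record Good (ms : List (Mark n)) (us : List (Edge n)) : Set where
      field
        matching : IsMatching G (matched ms us)
        chain    : Chain G (lefts (matched ms us)) ms
        bounded  : length ms + length us ≤ 2 * k

    -- Stability of the processed edges `os` is kept only while the state is unchanged, since a
    -- change may destroy it. A change is recorded by a larger potential instead.
    data Advance (os : List (Edge n)) : State n → State n → Set where
      stay : ∀ {c ms us} → All (Stable ms us) os → Advance os (search c ms us) (search c ms us)
      grow : ∀ {c ms us ms' us'} → Good ms' us' → potential ms us < potential ms' us' →
             Advance os (search c ms us) (search true ms' us')
      fail : ∀ {s} → ¬ HasVCAtMost (Adj G) k → Advance os s over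

    Advance-trans : ∀ {os os' s t t'} → Advance os s t → Advance os' t t' → Advance (os ++ os') s t'
    Advance-trans (stay st)    (stay st')   = stay (Allₚ.++⁺ st st')
    Advance-trans (stay st)    (grow g lt)  = grow g lt
    Advance-trans (grow g lt)  (stay _)     = grow g lt
    Advance-trans (grow _ lt)  (grow g lt') = grow g (<-trans lt lt')
    Advance-trans _            (fail ¬vc)   = fail ¬vc

    Invariant : State n → Set
    Invariant (search _ ms us) = Good ms us
    Invariant over             = ¬ HasVCAtMost (Adj G) k
    Invariant _                = ⊥

    Advance-invariant : ∀ {os s t} → Invariant s → Advance os s t → Invariant t
    Advance-invariant inv (stay _)   = inv
    Advance-invariant inv (grow g _) = g
    Advance-invariant inv (fail ¬vc) = ¬vc

    relax-advance : ∀ s {u v} → Invariant s → Adj G u v → Advance ((u , v) ∷ []) s (relax s (u , v))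
    relax-advance over inv _ = fail inv
    relax-advance (search c ms us) {u} {v} good uv
      with relax (search c ms us) (u , v) | relaxation c ms us u v
         | relax-bounded (search c ms us) (u , v) (Good.bounded good)
    ... | _ | stable st | _ = stay (st ∷ [])
    ... | _ | enlarge u∉ v∉ms v∉us _ | b = grow
      (record { matching = IsMatching-augment ms us matching chain uv u∉ v∉ms v∉us
              ; chain = _ ; bounded = b })
      (begin-strict
        (length ms + length us) * suc (2 * k) + length ms
          -- All marks are lost, but there are at most `2 * k` of them, fewer than the factor
          -- gained.
          <⟨ +-monoʳ-< ((length ms + length us) * suc (2 * k)) (s≤s (≤-trans (m≤m+n (length ms) _) bounded)) ⟩
        (length ms + length us) * suc (2 * k) + suc (2 * k)
          ≡⟨ +-comm _ (suc (2 * k)) ⟩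
        suc (length ms + length us) * suc (2 * k)
          ≡⟨ cong (_* suc (2 * k)) (trans (Listₚ.length-++ (augment ms (u , v)))
                                          (cong (_+ length us) (length-augment ms (u , v)))) ⟨
        length (augment ms (u , v) ++ us) * suc (2 * k)
          ≡⟨ +-identityʳ _ ⟨
        length (augment ms (u , v) ++ us) * suc (2 * k) + 0 ∎)
      where
      open Good good
      open ≤-Reasoning
    -- The oversized matching is not stored, but its existence contradicts a cover of size `k`.
    ... | _ | overflow u∉ v∉ms v∉us ≰2k | _ = fail λ vc →
      ≰2k (matching-≤ (IsMatching-augment ms us (Good.matching good) (Good.chain good) uv u∉ v∉ms v∉us) vc)
    ... | _ | mark u∉ {a} {rest} p | b = grow
      (record { matching = IsMatching-resp-↭ perm matching
              ; chain = uv , u-reach , Chain-map (λ q∉ q∈ → q∉ (↭ₚ.∈-resp-↭ (↭-sym perm-lefts) q∈)) ms chain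
              ; bounded = b })
      (begin-strict
        -- The edge moves from `us` to the marks: the matching keeps its size and gains one mark.
        (length ms + length us) * suc (2 * k) + length ms
          ≡⟨ cong (λ l → l * suc (2 * k) + length ms) (trans (cong (length ms +_) (↭ₚ.↭-length p)) (+-suc _ _)) ⟩
        suc (length ms + length rest) * suc (2 * k) + length ms
          <⟨ +-monoʳ-< (suc (length ms + length rest) * suc (2 * k)) ≤-refl ⟩
        suc (length ms + length rest) * suc (2 * k) + suc (length ms) ∎)
      where
      open Good good
      open ≤-Reasoning
      perm : matched ms us ↭ (a , v) ∷ matched ms rest
      perm = ↭-trans (↭ₚ.++⁺ˡ (map proj₁ ms) p) (↭ₚ.shift (a , v) (map proj₁ ms) rest)
      perm-lefts : lefts (matched ms us) ↭ a ∷ lefts (matched ms rest)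
      perm-lefts = ↭ₚ.map⁺ proj₁ perm
      u-reach : u ∈ lefts (map proj₁ ms) ⊎ u ∉ a ∷ lefts (matched ms rest)
      u-reach with u ∈? lefts (map proj₁ ms)
      ... | yes u∈  = inj₁ u∈
      ... | no u∉ms = inj₂ λ u∈ → Sum.[ u∉ms , u∉ ] (∈-++⁻ (lefts (map proj₁ ms))
              (subst (u ∈_) (Listₚ.map-++ proj₁ (map proj₁ ms) us) (↭ₚ.∈-resp-↭ (↭-sym perm-lefts) u∈)))

    -- Both directions in the order in which `process` tries them; the singletons fit
    -- `Advance-trans`.
    orientations : List (Edge n) → List (Edge n)
    orientations []       = []
    orientations (e ∷ es) = (e ∷ []) ++ (Product.swap e ∷ []) ++ orientations es

    ∈-orientations : ∀ {es u v} → (u , v) ∈ es ⊎ (v , u) ∈ es → (u , v) ∈ orientations es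
    ∈-orientations {e ∷ es} (inj₁ (here refl)) = here refl
    ∈-orientations {e ∷ es} (inj₂ (here refl)) = there (here refl)
    ∈-orientations {e ∷ es} (inj₁ (there e∈))  = there (there (∈-orientations (inj₁ e∈)))
    ∈-orientations {e ∷ es} (inj₂ (there e∈))  = there (there (∈-orientations (inj₂ e∈)))

    emit-[] : ∀ s e → Invariant s → emit s e ≡ []
    emit-[] (search _ _ _) e _ = refl
    emit-[] over           e _ = refl

    read-advance : ∀ s es → Invariant s → (∀ {u v} → (u , v) ∈ es → Adj G u v) →
                   proj₂ (read s es) ≡ [] × Advance (orientations es) s (proj₁ (read s es))
    read-advance (search c ms us) [] inv _ = refl , stay []
    read-advance over             [] inv _ = refl , fail inv
    read-advance s (e ∷ es) inv adj =
      trans (cong (_++ proj₂ (read (proj₁ (process s e)) es)) (emit-[] s e inv)) (proj₁ rest) ,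
      Advance-trans first (Advance-trans second (proj₂ rest))
      where
      first  = relax-advance s inv (adj (here refl))
      second = relax-advance (relax s e) (Advance-invariant inv first) (Graph.sym G (adj (here refl)))
      rest   = read-advance _ es (Advance-invariant (Advance-invariant inv first) second) (adj ∘ there)

    module _ {es : List (Edge n)} (isEdges : IsEdgeList G es) where

      open IsEdgeList isEdges

      run-done : ∀ q → proj₂ (run q done es) ≡ []
      run-done zero = refl
      run-done (suc q) = go es
        where
        -- Later passes still read all of `es`, so the induction along this pass runs over its own
        -- list.
        go : ∀ es' → (proj₂ (read done es') ++ proj₂ (finish (proj₁ (read done es')))) ++
                     proj₂ (run q (proj₁ (finish (proj₁ (read done es')))) es) ≡ []
        go []        = run-done q
        go (_ ∷ es') = go es'

      read-report : ∀ ms us es' → read (report ms us) es' ≡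
                    (report ms us , map (Kernel.edgeTok (weight ms us)) (concatMap (Kernel.kernelEdge (weight ms us)) es'))
      read-report ms us [] = refl
      read-report ms us (e ∷ es') rewrite read-report ms us es' = cong (report ms us ,_)
        (sym (Listₚ.map-++ edgeTok (kernelEdge e) _))
        where open Kernel (weight ms us)

      run-report : ∀ q ms us → Good ms us → (∀ {u v} → Adj G u v → Stable ms us (u , v)) →
                   ValidKernelOutput G k (proj₂ (run (suc q) (report ms us) es))
      run-report q ms us good st
        rewrite read-report ms us es | run-done q
              | Listₚ.++-identityʳ (map (Kernel.edgeTok (weight ms us)) (concatMap (Kernel.kernelEdge (weight ms us)) es)
                                    ++ Kernel.kernelOutput (weight ms us) k) =
        Kernel.kernelOutput-valid (weight ms us) matching (weight-cover {G = G} ms us st) (weight-tight ms us)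
          (≤-trans (≤-reflexive (length-matched ms us)) bounded) isEdges
        where open Good good

      -- Induction on the remaining passes `q`: a pass that changes the matching or marks uses one
      -- pass but raises the potential by at least one, which preserves the budget.
      run-search : ∀ q ms us → Good ms us → suc (suc (2 * k) * suc (2 * k)) ≤ potential ms us + q →
                   ValidKernelOutput G k (proj₂ (run q (search false ms us) es))
      run-search zero ms us good enough = contradiction enough (<⇒≱ (begin-strict
        potential ms us + 0        ≡⟨ +-identityʳ _ ⟩
        potential ms us            <⟨ potential-< ms us (Good.bounded good) ⟩
        suc (2 * k) * suc (2 * k)  <⟨ ≤-refl ⟩
        suc (suc (2 * k) * suc (2 * k)) ∎))
        where open ≤-Reasoning
      run-search (suc q) ms us good enough
        with read (search false ms us) es | read-advance (search false ms us) es good sound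
      ... | _ , _ | refl , stay st = stationary q enough
        where
        stationary : ∀ q → suc (suc (2 * k) * suc (2 * k)) ≤ potential ms us + suc q →
                     ValidKernelOutput G k (proj₂ (run q (report ms us) es))
        -- The outer `suc` of the budget guarantees a pass for reporting.
        stationary zero    enough = contradiction (potential-< ms us (Good.bounded good))
          (≤⇒≯ (s≤s⁻¹ (≤-trans enough (≤-reflexive (+-comm (potential ms us) 1)))))
        stationary (suc q) _      =
          run-report q ms us good λ a → All.lookup st (∈-orientations (complete a))
      ... | _ , _ | refl , grow {ms' = ms'} {us'} good' lt = run-search q ms' us' good' (begin
        suc (suc (2 * k) * suc (2 * k))   ≤⟨ enough ⟩
        potential ms us + suc q           ≡⟨ +-suc _ q ⟩
        suc (potential ms us) + q         ≤⟨ +-monoˡ-≤ q lt ⟩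
        potential ms' us' + q             ∎)
        where open ≤-Reasoning
      ... | _ , _ | refl , fail ¬vc = inj₁ (cong (OutTok.no ∷_) (run-done q) , ¬vc)

      run-valid : ValidKernelOutput G k (proj₂ (run (suc (suc (2 * k) * suc (2 * k))) (search false [] []) es))
      run-valid = run-search _ [] []
        (record { matching = mkMatching [] [] [] ; chain = tt ; bounded = z≤n }) ≤-refl

-- Encoding states by bit vectors

-- Only a section is required: vectors outside the image of `encode` may decode to anything.
record Code (A : Set) (b : ℕ) : Set where
  field
    encode        : A → Vec Bool b
    decode        : Vec Bool b → Maybe A
    decode-encode : ∀ a → decode (encode a) ≡ just a
open Code

take-++ : ∀ {l m} (xs : Vec X l) (ys : Vec X m) → Vec.take l (xs Vec.++ ys) ≡ xs
take-++ []       ys = refl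
take-++ (x ∷ xs) ys = cong (x ∷_) (take-++ xs ys)

drop-++ : ∀ {l m} (xs : Vec X l) (ys : Vec X m) → Vec.drop l (xs Vec.++ ys) ≡ ys
drop-++ []       ys = refl
drop-++ (x ∷ xs) ys = drop-++ xs ys

n<2^suclog₂n : ∀ n → n < 2 ^ suc ⌊log₂ n ⌋
n<2^suclog₂n n = ≰⇒> λ 2^≤n → <-irrefl refl (≤-trans
  (≤-reflexive (sym (⌊log₂[2^n]⌋≡n (suc ⌊log₂ n ⌋)))) (⌊log₂⌋-mono-≤ 2^≤n))

binary : ∀ w → Fin (2 ^ w) → Vec Bool w
binary zero    _ = []
binary (suc w) i = Inverse.to 2↔Bool (Fin.quotient {2} (2 ^ w) i) ∷ binary w (Fin.remainder {2} (2 ^ w) i)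

value : ∀ w → Vec Bool w → Fin (2 ^ w)
value zero    []      = zero
value (suc w) (b ∷ v) = Fin.combine {2} (Inverse.from 2↔Bool b) (value w v)

value-binary : ∀ w i → value w (binary w i) ≡ i
value-binary zero    zero = refl
value-binary (suc w) i = trans
  (cong₂ (Fin.combine {2}) (Inverse.strictlyInverseʳ 2↔Bool (Fin.quotient {2} (2 ^ w) i))
                     (value-binary w (Fin.remainder {2} (2 ^ w) i)))
  (combine-remQuot {2} (2 ^ w) i)

finCode : ∀ {w} → n ≤ 2 ^ w → Code (Fin n) w
finCode {n} {w} n≤ = record { encode = enc ; decode = dec ; decode-encode = dec-enc }
  where
  enc : Fin n → Vec Bool w
  enc i = binary w (Fin.inject≤ i n≤)
  dec : Vec Bool w → Maybe (Fin n)
  dec v with toℕ (value w v) <? n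
  ... | yes i<n = just (fromℕ< i<n)
  ... | no _    = nothing
  dec-enc : ∀ i → dec (enc i) ≡ just i
  dec-enc i with toℕ (value w (enc i)) <? n
  ... | yes i<n = cong just (toℕ-injective (trans (toℕ-fromℕ< i<n) toℕ-value))
    where
    toℕ-value : toℕ (value w (enc i)) ≡ toℕ i
    toℕ-value = trans (cong toℕ (value-binary w _)) (toℕ-inject≤ i n≤)
  ... | no i≮n = contradiction
    (subst (_< n) (sym (trans (cong toℕ (value-binary w _)) (toℕ-inject≤ i n≤))) (toℕ<n i)) i≮n

infixr 2 _×-code_
_×-code_ : ∀ {A B : Set} {b c} → Code A b → Code B c → Code (A × B) (b + c)
_×-code_ {b = b} α β = record
  { encode        = λ (x , y) → encode α x Vec.++ encode β y
  ; decode        = λ v → Maybe.zip (decode α (Vec.take b v)) (decode β (Vec.drop b v))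
  ; decode-encode = λ (x , y) → cong₂ Maybe.zip
      (trans (cong (decode α) (take-++ (encode α x) (encode β y))) (decode-encode α x))
      (trans (cong (decode β) (drop-++ (encode α x) (encode β y))) (decode-encode β y))
  }

module _ {A : Set} {b : ℕ} (α : Code A b) where

  -- Truncates lists of length greater than m.
  encodeList : ∀ m → List A → Vec Bool (m * suc b)
  encodeList zero    _        = []
  -- A leading `false` ends the list; the rest is padding.
  encodeList (suc m) []       = Vec.replicate _ false
  encodeList (suc m) (x ∷ xs) = true ∷ encode α x Vec.++ encodeList m xs

  decodeList : ∀ m → Vec Bool (m * suc b) → Maybe (List A)
  decodeList zero    _           = just []
  decodeList (suc m) (false ∷ _) = just []
  decodeList (suc m) (true ∷ v)  =
    Maybe.zipWith _∷_ (decode α (Vec.take b v)) (decodeList m (Vec.drop b v))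

  decode-encodeList : ∀ m xs → length xs ≤ m → decodeList m (encodeList m xs) ≡ just xs
  decode-encodeList zero    []       _       = refl
  decode-encodeList (suc m) []       _       = refl
  decode-encodeList (suc m) (x ∷ xs) (s≤s ≤m) = cong₂ (Maybe.zipWith _∷_)
    (trans (cong (decode α) (take-++ (encode α x) (encodeList m xs))) (decode-encode α x))
    (trans (cong (decodeList m) (drop-++ (encode α x) (encodeList m xs))) (decode-encodeList m xs ≤m))

-- The bit-level algorithm and its resource bounds

module Encoded (n k : ℕ) where

  open Algorithm {n} k

  w : ℕ
  w = suc ⌊log₂ n ⌋

  vertexCode : Code (Fin n) w
  vertexCode = finCode (<⇒≤ (n<2^suclog₂n n))

  edgeCode : Code (Edge n) (w + w)
  edgeCode = vertexCode ×-code vertexCode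

  markCode : Code (Mark n) (w + w + w)
  markCode = edgeCode ×-code vertexCode

  -- Marks and unmarked edges each get `2 * k` slots, with one presence bit per slot; three bits
  -- hold the kind of state and the flag.
  listBits bits : ℕ
  listBits = 2 * k * suc (w + w + w) + 2 * k * suc (w + w)
  bits     = 3 + listBits

  encodeLists : List (Mark n) → List (Edge n) → Vec Bool listBits
  encodeLists ms us = encodeList markCode (2 * k) ms Vec.++ encodeList edgeCode (2 * k) us

  decodeLists : (List (Mark n) → List (Edge n) → State n) → Vec Bool listBits → State n
  -- `done` is an arbitrary default for vectors that encode no lists.
  decodeLists f v = Maybe.fromMaybe done (Maybe.zipWith f
    (decodeList markCode (2 * k) (Vec.take _ v)) (decodeList edgeCode (2 * k) (Vec.drop (2 * k * suc (w + w + w)) v)))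

  decode-encodeLists : ∀ f ms us → length ms + length us ≤ 2 * k →
                       decodeLists f (encodeLists ms us) ≡ f ms us
  decode-encodeLists f ms us b = cong (Maybe.fromMaybe done) (cong₂ (Maybe.zipWith f)
    (trans (cong (decodeList markCode (2 * k)) (take-++ ems eus))
           (decode-encodeList markCode (2 * k) ms (≤-trans (m≤m+n _ _) b)))
    (trans (cong (decodeList edgeCode (2 * k)) (drop-++ ems eus))
           (decode-encodeList edgeCode (2 * k) us (≤-trans (m≤n+m _ _) b))))
    where
    ems = encodeList markCode (2 * k) ms
    eus = encodeList edgeCode (2 * k) us

  encodeState : State n → Vec Bool bits
  encodeState (search c ms us) = true ∷ true ∷ c ∷ encodeLists ms us
  encodeState (report ms us)   = true ∷ false ∷ false ∷ encodeLists ms us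
  encodeState over             = false ∷ false ∷ false ∷ Vec.replicate _ false
  encodeState done             = false ∷ true ∷ false ∷ Vec.replicate _ false

  decodeState : Vec Bool bits → State n
  decodeState (true ∷ true ∷ c ∷ v)   = decodeLists (search c) v
  decodeState (true ∷ false ∷ _ ∷ v)  = decodeLists report v
  decodeState (false ∷ false ∷ _ ∷ _) = over
  decodeState (false ∷ true ∷ _ ∷ _)  = done

  decode-encodeState : ∀ s → Bounded s → decodeState (encodeState s) ≡ s
  decode-encodeState (search c ms us) b = decode-encodeLists (search c) ms us b
  decode-encodeState (report ms us)   b = decode-encodeLists report ms us b
  decode-encodeState over             b = refl
  decode-encodeState done             b = refl

  rounds : ℕ
  rounds = suc (suc (2 * k) * suc (2 * k))

  rounds-≤ : rounds ≤ 14 * suc k ^ 2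
  -- The braces hold the slack, which turns the bound into a polynomial identity. The constant 14 is
  -- shared with the memory bound.
  rounds-≤ = m+n≤o⇒m≤o rounds {12 + 24 * k + 10 * (k * k)} (≤-reflexive
    (solve 1 (λ k → con 1 :+ (con 1 :+ con 2 :* k) :* (con 1 :+ con 2 :* k) :+ (con 12 :+ con 24 :* k :+ con 10 :* (k :* k))
      := con 14 :* ((con 1 :+ k) :* ((con 1 :+ k) :* con 1))) refl k))
    where open +-*-Solver

  bits-≤ : bits ≤ MemBound 14 1 n k
  -- With `l` the logarithm, `bits` is `3 + 14 * k + 10 * k * l`; the constant is the coefficient of
  -- `k`.
  bits-≤ = m+n≤o⇒m≤o bits {11 + 14 * ⌊log₂ n ⌋ + 4 * k * ⌊log₂ n ⌋} (≤-reflexive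
    (solve 2 (λ k l → let w = con 1 :+ l in
      con 3 :+ (con 2 :* k :* (con 1 :+ (w :+ w :+ w)) :+ con 2 :* k :* (con 1 :+ (w :+ w)))
        :+ (con 11 :+ con 14 :* l :+ con 4 :* k :* l)
      := con 14 :* (con 1 :+ k) :* (w :* con 1)) refl k ⌊log₂ n ⌋))
    where open +-*-Solver

  module _ {In : Set} (edgesOf : In → List (Edge n)) where

    algorithm : StreamAlg In bits
    algorithm = record
      { init    = encodeState (search false [] [])
      ; step    = λ σ x → Product.map₁ encodeState (read (decodeState σ) (edgesOf x))
      ; endPass = λ σ → Product.map₁ encodeState (finish (decodeState σ))
      }

    read-++ : ∀ s xs ys → read s (xs ++ ys) ≡
              (proj₁ (read (proj₁ (read s xs)) ys) , proj₂ (read s xs) ++ proj₂ (read (proj₁ (read s xs)) ys))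
    read-++ s []       ys = refl
    read-++ s (x ∷ xs) ys rewrite read-++ (proj₁ (process s x)) xs ys =
      cong (proj₁ (read (proj₁ (read (proj₁ (process s x)) xs)) ys) ,_) (sym (Listₚ.++-assoc (emit s x) _ _))

    -- Bounded states survive the round trip through bits and `read` keeps them bounded, so the
    -- encoded machine simulates `read`.
    readStream-read : ∀ s xs → Bounded s → readStream (step algorithm) (encodeState s) xs ≡
                      Product.map₁ encodeState (read s (concatMap edgesOf xs))
    readStream-read s []       _ = refl
    readStream-read s (x ∷ xs) b
      rewrite decode-encodeState s b
            | readStream-read (proj₁ (read s (edgesOf x))) xs (read-bounded s (edgesOf x) b)
            | read-++ s (edgesOf x) (concatMap edgesOf xs) = refl

    onePass-pass : ∀ s xs → Bounded s → onePass algorithm (encodeState s) xs ≡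
                   Product.map₁ encodeState (pass s (concatMap edgesOf xs))
    onePass-pass s xs b
      rewrite readStream-read s xs b
            | decode-encodeState _ (read-bounded s (concatMap edgesOf xs) b) = refl

    passes-run : ∀ q s xs → Bounded s → passes algorithm q (encodeState s) xs ≡
                 Product.map₁ encodeState (run q s (concatMap edgesOf xs))
    passes-run zero    s xs b = refl
    passes-run (suc q) s xs b = trans
      (cong (λ r → let t = passes algorithm q (proj₁ r) xs in proj₁ t , proj₂ r ++ proj₂ t) (onePass-pass s xs b))
      (cong (λ t → proj₁ t , proj₂ (pass s es) ++ proj₂ t)
        (passes-run q (proj₁ (pass s es)) xs (finish-bounded _ (read-bounded s es b))))
      where es = concatMap edgesOf xs

    algorithm-valid : ∀ {G : Graph n} xs → IsEdgeList G (concatMap edgesOf xs) →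
                      ValidKernelOutput G k (runOutput algorithm rounds xs)
    algorithm-valid {G} xs isEdges = subst (ValidKernelOutput G k)
      (sym (cong proj₂ (passes-run rounds (search false [] []) xs z≤n)))
      (Correctness.run-valid G isEdges)

-- The two stream models

edgesOfAL : ALTok n → List (Edge n)
edgesOfAL (vtx _)   = []
edgesOfAL (inc u v) = (u , v) ∷ []

edgesOfEA : Edge n → List (Edge n)
edgesOfEA e = e ∷ []

al-isEdgeList : {G : Graph n} {s : List (ALTok n)} → IsALStream G s → IsEdgeList G (concatMap edgesOfAL s)
al-isEdgeList {n} {G} (order , nbrs , perm , _ , adj , refl) = record
  { sound    = λ uv∈ → sound (find (∈-concatMap⁻ edgesOfAL {xs = concatMap block order} uv∈))
  ; complete = λ {u} {v} a → inj₁ (∈-concatMap⁺ edgesOfAL (lose (inc∈ a) (here refl)))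
  }
  where
  block : Fin n → List (ALTok n)
  block u = vtx u ∷ map (inc u) (nbrs u)
  inc∈ : ∀ {u v} → Adj G u v → inc u v ∈ concatMap block order
  inc∈ {u} {v} a = ∈-concatMap⁺ block (lose (↭ₚ.∈-resp-↭ (↭-sym perm) (∈-allFin u))
    (there (∈-map⁺ (inc u) (Equivalence.from (adj u v) a))))
  inBlock : ∀ {u v x} → inc u v ∈ block x → Adj G u v
  inBlock {x = x} (there inc∈) with ∈-map⁻ (inc x) inc∈
  ... | _ , v∈ , refl = Equivalence.to (adj _ _) v∈
  sound : ∀ {u v} → (∃ λ x → x ∈ concatMap block order × (u , v) ∈ edgesOfAL x) → Adj G u v
  sound (inc _ _ , x∈ , here refl) with find (∈-concatMap⁻ block {xs = order} x∈)
  ... | _ , _ , x∈block = inBlock x∈block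

ea-isEdgeList : {G : Graph n} {s : List (Edge n)} → IsEAStream G s → IsEdgeList G (concatMap edgesOfEA s)
ea-isEdgeList {n} {G} {s} (adj , complete , _) = subst (IsEdgeList G) (sym (Listₚ.concat-map-[_] s)) (record
  { sound    = λ uv∈ → All.lookup adj uv∈
  ; complete = λ {u} {v} → complete u v
  })

theorem44 : (Σ ℕ λ c → Σ ℕ λ d → ∀ (n k : ℕ) →
    Σ ℕ λ p → Σ ℕ λ b → Σ (StreamAlg (ALTok n) b) λ A →
    (p ≤ c * (suc k ^ 2)) × (b ≤ MemBound c d n k)
    × (∀ (G : Graph n) (s : List (ALTok n)) → IsALStream G s →
    ValidKernelOutput G k (runOutput A p s)))
    × (Σ ℕ λ c → Σ ℕ λ d → ∀ (n k : ℕ) →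
    Σ ℕ λ p → Σ ℕ λ b → Σ (StreamAlg (Fin n × Fin n) b) λ A →
    (p ≤ c * (suc k ^ 3)) × (b ≤ MemBound c d n k)
    × (∀ (G : Graph n) (s : List (Fin n × Fin n)) → IsEAStream G s →
    ValidKernelOutput G k (runOutput A p s)))
theorem44 =
  (14 , 1 , λ n k → let open Encoded n k in
    rounds , bits , algorithm edgesOfAL , rounds-≤ , bits-≤ ,
    λ G s isStream → algorithm-valid edgesOfAL {G} s (al-isEdgeList isStream)) ,
  (14 , 1 , λ n k → let open Encoded n k in
    rounds , bits , algorithm edgesOfEA ,
    -- The quadratic bound holds for this model too; the cubic one follows because `suc k` is at
    -- least 1.
    ≤-trans rounds-≤ (*-monoʳ-≤ 14 (^-monoʳ-≤ (suc k) (n≤1+n 2))) , bits-≤ ,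
    λ G s isStream → algorithm-valid edgesOfEA {G} s (ea-isEdgeList isStream))
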